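{- Let $k\ge 2$, let $B=M\cup\{\omega_1,\ldots,\omega_p\}$ with $p\ge 1$ and $\omega_1,\ldots,\omega_p\in P_k\setminus M$, and let $F$ be a finite system of functions from $P_k(n)$. Then $$I_B(F)\le\left\lceil \log_{u(B)}\bigl(d(F)+1\bigr)\right\rceil .$$
   Context: Let $k\ge 2$ be an integer and $E_k=\{0,1,\ldots,k-1\}$. $P_k(n)$ denotes the set of all functions $E_k^n\to E_k$, and $P_k=\bigcup_n P_k(n)$. Tuples in $E_k^n$ are ordered componentwise: $\tilde\alpha\le\tilde\beta$ iff $\alpha_j\le\beta_j$ for all $j$. A function $f$ is monotone if $\tilde\alpha\le\tilde\beta$ implies $f(\tilde\alpha)\le f(\tilde\beta)$; $M$ is the set of all monotone functions in $P_k$ (of all arities, including constants). A basis is a set $B=M\cup\{\omega_1,\ldots,\omega_p\}$ with $p\ge1$ and $\omega_i\in P_k\setminus M$. A circuit over $B$ with inputs $x_1,\ldots,x_n$ is a finite directed acyclic graph whose source nodes are labelled by the variables $x_1,\ldots,x_n$ and each of whose other nodes (gates) is labelled by a $q$-ary function from $B$ and has $q$ ordered incoming edges; each node computes a function of $P_k(n)$ in the obvious way. A circuit realizes a system $F$ of functions of $x_1,\ldots,x_n$ if every function of $F$ is computed at some node. Gates labelled by functions of $M$ have weight $0$, gates labelled by some $\omega_i$ have weight $1$. The non-monotone complexity $I_B(S)$ of a circuit $S$ is the sum of the weights of its gates; $I_B(F)$ is the minimum of $I_B(S)$ over all circuits $S$ over $B$ realizing $F$. A chain is a sequence $\tilde\alpha_1,\ldots,\tilde\alpha_r$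 of pairwise distinct tuples of $E_k^n$ with $\tilde\alpha_i\le\tilde\alpha_{i+1}$ for $i=1,\ldots,r-1$. A pair $(\tilde\alpha,\tilde\beta)$ with $\tilde\alpha\le\tilde\beta$ is a jump for a system $F$ if $f(\tilde\alpha)>f(\tilde\beta)$ for at least one $f\in F$. For a chain $C=(\tilde\alpha_1,\ldots,\tilde\alpha_r)$, the decrease $d_C(F)$ is the number of $i\in\{1,\ldots,r-1\}$ such that $(\tilde\alpha_i,\tilde\alpha_{i+1})$ is a jump for $F$. The decrease $d(F)$ is the maximum of $d_C(F)$ over all chains $C$ in $E_k^n$. For $f\in P_k(n)$ and a chain $C=(\tilde\alpha_1,\ldots,\tilde\alpha_r)$ in $E_k^n$, $u_C(f)$ is the maximum length $t$ of a subsequence $\tilde\beta_1,\ldots,\tilde\beta_t$ of $C$ (taken in the order of $C$) with $f(\tilde\beta_1)>f(\tilde\beta_2)>\cdots>f(\tilde\beta_t)$. The inversion power $u(f)$ is the maximum of $u_C(f)$ over all chains $C$ in $E_k^n$, and the inversion power of the basis is $u(B)=\max\{u(f): f\in B\}$ (note $u(B)\ge 2$ since $B$ contains a non-monotone function). -}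

module Defs where

open import Data.Fin using (Fin) renaming (_≤_ to _≤ᶠ_; _<_ to _<ᶠ_)
open import Data.Fin.Properties using () renaming (_≤?_ to _≤ᶠ?_; _<?_ to _<ᶠ?_)
open import Data.Fin.Induction using (spo-wellFounded)
open import Data.List using (List; length; filter; zip; drop)
open import Data.List.Relation.Binary.Sublist.Propositional using (_⊆_)
open import Data.List.Relation.Unary.All using (All)
open import Data.List.Relation.Unary.Any using (Any; any?)
open import Data.List.Relation.Unary.Linked using (Linked)
open import Data.List.Relation.Unary.Unique.Propositional using (Unique)
open import Data.Nat using (ℕ; _≤_; _^_)
open import Data.Product using (_×_; _,_; ∃-syntax; uncurry)
open import Data.Empty using (⊥)
open import Data.Vec using (Vec; lookup; tabulate; sum)
open import Data.Vec.Membership.Propositional using (_∈_)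
open import Data.Vec.Membership.Propositional.Properties using (∈-lookup)
open import Data.Vec.Relation.Binary.Pointwise.Inductive using (Pointwise; decidable)
open import Induction.WellFounded using (Acc; acc; WellFounded)
open import Relation.Binary using (Decidable; IsStrictPartialOrder)
open import Relation.Binary.Construct.Closure.Transitive
  using (TransClosure; transitive; wellFounded⁻)
open import Relation.Binary.PropositionalEquality
  using (_≡_; refl; isEquivalence)
open import Relation.Nullary using (¬_; _×-dec_)

IsMaximum : (ℕ → Set) → ℕ → Set
IsMaximum A m = A m × (∀ j → A j → j ≤ m)

IsMinimum : (ℕ → Set) → ℕ → Set
IsMinimum A m = A m × (∀ j → A j → m ≤ j)

-- t = ⌈ log_u m ⌉ for u ≥ 2 and m ≥ 1: the logarithm is then ≥ 0, so its
-- ceiling is the least natural number t with log_u m ≤ t, i.e. m ≤ u ^ t.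
IsCeilLog : (u m t : ℕ) → Set
IsCeilLog u m = IsMinimum (λ t → m ≤ u ^ t)

Tuple : ℕ → ℕ → Set
Tuple k n = Vec (Fin k) n

P : ℕ → ℕ → Set
P k n = Tuple k n → Fin k

module _ {k n : ℕ} where

  infix 4 _≼_ _≼?_

  _≼_ : Tuple k n → Tuple k n → Set
  _≼_ = Pointwise _≤ᶠ_

  _≼?_ : Decidable _≼_
  _≼?_ = decidable _≤ᶠ?_

  Monotone : P k n → Set
  Monotone f = ∀ {α β} → α ≼ β → f α ≤ᶠ f β

  IsChain : List (Tuple k n) → Set
  IsChain C = Unique C × Linked _≼_ C

  Jump : List (P k n) → Tuple k n → Tuple k n → Set
  Jump F α β = α ≼ β × Any (λ f → f β <ᶠ f α) F

  jump? : (F : List (P k n)) → Decidable (Jump F)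
  jump? F α β = (α ≼? β) ×-dec any? (λ f → f β <ᶠ? f α) F

  decreaseAlong : List (Tuple k n) → List (P k n) → ℕ
  decreaseAlong C F = length (filter (uncurry (jump? F)) (zip C (drop 1 C)))

  IsDecrease : List (P k n) → ℕ → Set
  IsDecrease F = IsMaximum (λ m → ∃[ C ] IsChain C × decreaseAlong C F ≡ m)

  IsInversionPowerAlong : List (Tuple k n) → P k n → ℕ → Set
  IsInversionPowerAlong C f = IsMaximum
    (λ t → ∃[ βs ] βs ⊆ C × Linked (λ α β → f β <ᶠ f α) βs × length βs ≡ t)

  IsInversionPower : P k n → ℕ → Set
  IsInversionPower f = IsMaximum
    (λ m → ∃[ C ] IsChain C × IsInversionPowerAlong C f m)

record Basis (k : ℕ) : Set where
  field
    p           : ℕ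
    p≥1         : 1 ≤ p
    arity       : Fin p → ℕ
    ω           : ∀ i → P k (arity i)
    nonMonotone : ∀ i → ¬ Monotone (ω i)

infix 4 _∋_

data _∋_ {k} (B : Basis k) : ∀ {q} → P k q → Set where
  monotone : ∀ {q} {f : P k q} → Monotone f → B ∋ f
  ω        : ∀ i → B ∋ Basis.ω B i

IsBasisInversionPower : ∀ {k} → Basis k → ℕ → Set
IsBasisInversionPower {k} B = IsMaximum
  (λ m → ∃[ q ] ∃[ f ] (B ∋ f) × IsInversionPower {k} {q} f m)

module _ {k : ℕ} (B : Basis k) where

  -- Labels of the nodes of a circuit with s nodes and inputs x₁, …, xₙ; a gate
  -- carries its predecessors, in order.
  data Label (n s : ℕ) : Set where
    input : Fin n → Label n s
    gate  : ∀ {q} {f : P k q} → B ∋ f → Vec (Fin s) q → Label n s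

module _ {k : ℕ} {B : Basis k} where

  weight : ∀ {n s} → Label B n s → ℕ
  weight (input _)             = 0
  weight (gate (monotone _) _) = 0
  weight (gate (ω _) _)        = 1

  IsPredecessor : ∀ {n s} → Fin s → Label B n s → Set
  IsPredecessor w (input _)     = ⊥
  IsPredecessor w (gate _ args) = w ∈ args

record Circuit {k} (B : Basis k) (n : ℕ) : Set where
  field
    size  : ℕ
    label : Fin size → Label B n size

  infix 4 _⟶_

  _⟶_ : Fin size → Fin size → Set
  w ⟶ v = IsPredecessor w (label v)

  field
    acyclic : ∀ v → ¬ TransClosure _⟶_ v v

  ⟶-wellFounded : WellFounded _⟶_
  ⟶-wellFounded = wellFounded⁻ _⟶_ (spo-wellFounded isSPO)
    where
    isSPO : IsStrictPartialOrder _≡_ (TransClosure _⟶_)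
    isSPO = record
      { isEquivalence = isEquivalence
      ; irrefl        = λ { {v} refl → acyclic v }
      ; trans         = transitive _⟶_
      ; <-resp-≈      = (λ { refl r → r }) , (λ { refl r → r })
      }

  mutual
    eval : ∀ v → Acc _⟶_ v → P k n
    eval v (acc rs) = evalLabel (label v) rs

    evalLabel : (l : Label B n size) →
                (∀ {w} → IsPredecessor w l → Acc _⟶_ w) → P k n
    evalLabel (input i) rs x = lookup x i
    evalLabel (gate {f = f} _ args) rs x =
      f (tabulate (λ j → eval (lookup args j) (rs (∈-lookup j args)) x))

  value : Fin size → P k n
  value v = eval v (⟶-wellFounded v)

  nonMonotoneComplexity : ℕ
  nonMonotoneComplexity = sum (tabulate (λ v → weight (label v)))

  Realizes : List (P k n) → Set
  Realizes = All (λ f → ∃[ v ] (∀ x → value v x ≡ f x))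

open Circuit public using (Realizes; nonMonotoneComplexity)

IsNonMonotoneComplexity : ∀ {k n} → Basis k → List (P k n) → ℕ → Set
IsNonMonotoneComplexity {n = n} B F = IsMinimum
  (λ c → ∃[ S ] Realizes {B = B} {n} S F × nonMonotoneComplexity S ≡ c)

{-# OPTIONS --safe #-}
module Submission where

-- Measure F by a monotone rank ρ with values below u ^ t that increases at
-- every jump; ρ(α) = d(F) − (most jumps on a chain starting from α) is one when
-- d(F) + 1 ≤ u ^ t.  For t = 0 all functions are monotone.  For t + 1, choose
-- β₀ ≼ … ≼ β_{u−1} with ω(β₀) > … > ω(β_{u−1}); the tuple of monotone functions
-- h(α) = β_{⌊ρ(α) / u ^ t⌋} feeds a single gate, giving the antitone w = ω ∘ h.
-- Put f′(y, α) = f(α) if y = w(α), the least value of E_k if y < w(α), and the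
-- greatest if y > w(α), so that f(α) = f′(w(α), α).  A pair (y, α) ≼ (y′, β) can
-- be a jump for f′ only if y = w(α) and y′ = w(β); then y ≤ y′ and w(β) ≤ w(α)
-- force w(α) = w(β), whence α and β lie on the same level of ρ.  So
-- ρ mod u ^ t, extended off the graph of w like f, is a rank for the f′, and t
-- more gates suffice.

open import Defs
open import Data.Fin using (Fin; zero; suc; toℕ; fromℕ; fromℕ<; quotient; remainder; combine)
  renaming (_≤_ to _≤ᶠ_; _<_ to _<ᶠ_)
import Data.Fin.Properties as Fin
open import Data.List using (List; []; _∷_; length)
import Data.List as List
open import Data.List.Properties using (filter-accept; filter-reject)
open import Data.List.Membership.Propositional using (lose)
open import Data.List.Membership.Propositional.Properties using () renaming (∈-lookup to ∈ˡ-lookup)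
open import Data.List.Relation.Binary.Sublist.Propositional using (_⊆_; []; _∷_; _∷ʳ_)
open import Data.List.Relation.Binary.Sublist.Propositional.Properties using (All-resp-⊆)
import Data.List.Relation.Unary.All as All
open import Data.List.Relation.Unary.AllPairs using (AllPairs; []; _∷_)
import Data.List.Relation.Unary.AllPairs as AllPairs
import Data.List.Relation.Unary.Any as Any
open import Data.List.Relation.Unary.Any.Properties using (lookup-index)
open import Data.List.Relation.Unary.Linked using (Linked; []; [-]; _∷_)
import Data.List.Relation.Unary.Linked as Linked
open import Data.List.Relation.Unary.Linked.Properties using (Linked⇒AllPairs)
open import Data.Nat using (ℕ; zero; suc; _+_; _*_; _^_; _∸_; _≤_; _<_; z≤n; s≤s)
import Data.Nat.Properties as ℕ
open import Data.Product using (_×_; Σ-syntax; ∃-syntax; _,_; proj₁; proj₂; uncurry)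
open import Data.Sum using (_⊎_; inj₁; inj₂)
open import Data.Unit using (⊤; tt)
open import Data.Vec using (Vec; []; _∷_; lookup; map; tabulate; sum)
open import Data.Vec.Membership.Propositional using (_∈_)
open import Data.Vec.Membership.Propositional.Properties using (∈-lookup)
open import Data.Vec.Properties
  using (≡-dec; lookup-map; map-cong; map-∘; tabulate-∘; tabulate-cong; tabulate∘lookup)
open import Data.Vec.Relation.Binary.Pointwise.Inductive using ([]; _∷_)
import Data.Vec.Relation.Binary.Pointwise.Inductive as Pointwise
import Data.Vec.Relation.Unary.Any as VecAny
open import Function using (_∘_; case_of_)
open import Induction.WellFounded using (Acc; acc)
open import Relation.Binary using (tri<; tri≈; tri>)
open import Relation.Binary.Construct.Closure.Transitive using (TransClosure; [_]; _∷_)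
open import Relation.Binary.PropositionalEquality
open import Relation.Nullary using (¬_; Dec; yes; no; contradiction)
open import Relation.Nullary.Decidable using (map′; _×-dec_)
open Circuit using (size; label; acyclic; eval; evalLabel; value)

-- Lists, the order on tuples, and finite search

AllPairs-resp-⊆ : ∀ {A : Set} {R : A → A → Set} {xs ys} → xs ⊆ ys → AllPairs R ys → AllPairs R xs
AllPairs-resp-⊆ []         []         = []
AllPairs-resp-⊆ (y ∷ʳ p)   (_ ∷ Rys)  = AllPairs-resp-⊆ p Rys
AllPairs-resp-⊆ (refl ∷ p) (Ry ∷ Rys) = All-resp-⊆ p Ry ∷ AllPairs-resp-⊆ p Rys

AllPairs-lookup : ∀ {A : Set} {R : A → A → Set} {xs} → AllPairs R xs →
                  ∀ {i j} → i <ᶠ j → R (List.lookup xs i) (List.lookup xs j)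
AllPairs-lookup (Rx ∷ _)  {zero}  {suc j} _         = All.lookup Rx (∈ˡ-lookup j)
AllPairs-lookup (_ ∷ Rxs) {suc i} {suc j} (s≤s i<j) = AllPairs-lookup Rxs i<j

module _ {k n : ℕ} where

  ≼-refl : {α : Tuple k n} → α ≼ α
  ≼-refl = Pointwise.refl Fin.≤-refl

  ≼-trans : {α β γ : Tuple k n} → α ≼ β → β ≼ γ → α ≼ γ
  ≼-trans = Pointwise.trans Fin.≤-trans

≼-antisym : ∀ {k n} {α β : Tuple k n} → α ≼ β → β ≼ α → α ≡ β
≼-antisym []         []         = refl
≼-antisym (a≤b ∷ α≼β) (b≤a ∷ β≼α) = cong₂ _∷_ (Fin.≤-antisym a≤b b≤a) (≼-antisym α≼β β≼α)

anyTuple? : ∀ {k} n {Q : Tuple k n → Set} → (∀ α → Dec (Q α)) → Dec (∃[ α ] Q α)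
anyTuple? zero    Q? = map′ ([] ,_) (λ { ([] , q) → q }) (Q? [])
anyTuple? (suc n) Q? =
  map′ (λ { (i , α , q) → i ∷ α , q }) (λ { (i ∷ α , q) → i , α , q })
       (Fin.any? λ i → anyTuple? n λ α → Q? (i ∷ α))

maximum : {Q : ℕ → Set} → (∀ j → Dec (Q j)) → Q 0 →
          ∀ d → (∀ j → Q j → j ≤ d) → ∃[ m ] IsMaximum Q m
maximum Q? q₀ zero    bound = 0 , q₀ , bound
maximum Q? q₀ (suc d) bound with Q? (suc d)
... | yes q = suc d , q , bound
... | no ¬q = maximum Q? q₀ d λ j q →
  ℕ.≤-pred (ℕ.≤∧≢⇒< (bound j q) λ { refl → ¬q q })

-- Ranks, and the rank given by the decrease

record Rank {k m r} (G : Fin r → P k m) (s : ℕ) : Set where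
  field
    rank       : Tuple k m → Fin s
    rank-mono  : ∀ {α β} → α ≼ β → rank α ≤ᶠ rank β
    rank-jumps : ∀ {α β} i → α ≼ β → G i β <ᶠ G i α → rank α <ᶠ rank β

module _ {k n : ℕ} (F : List (P k n)) where

  private
    _≟_ : (α β : Tuple k n) → Dec (α ≡ β)
    _≟_ = ≡-dec Fin._≟_

    _≺_ : Tuple k n → Tuple k n → Set
    α ≺ β = α ≼ β × α ≢ β

    ≺-trans : ∀ {α β γ} → α ≺ β → β ≺ γ → α ≺ γ
    ≺-trans (α≼β , α≢β) (β≼γ , _) =
      ≼-trans α≼β β≼γ , λ { refl → α≢β (≼-antisym α≼β β≼γ) }

    Linked-≺⇒IsChain : ∀ {C} → Linked _≺_ C → IsChain C
    Linked-≺⇒IsChain l =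
      AllPairs.map proj₂ (Linked⇒AllPairs ≺-trans l) , Linked.map proj₁ l

  Jump⇒≺ : ∀ {α β} → Jump F α β → α ≺ β
  Jump⇒≺ (α≼β , jump) = α≼β , λ { refl → ℕ.<-irrefl refl (proj₂ (Any.satisfied jump)) }

  -- A chain from `α` is recorded only by `j` of its jumps. The step `α ≼ β` between jumps may be an
  -- equality or skip tuples, so the property is decided by searching over pairs of tuples and is
  -- inherited by every tuple below `α`.
  DecreasesFrom : ℕ → Tuple k n → Set
  DecreasesFrom zero    α = ⊤
  DecreasesFrom (suc j) α = ∃[ β ] ∃[ γ ] α ≼ β × Jump F β γ × DecreasesFrom j γ

  decreasesFrom? : ∀ j α → Dec (DecreasesFrom j α)
  decreasesFrom? zero    α = yes tt
  decreasesFrom? (suc j) α = anyTuple? n λ β → anyTuple? n λ γ →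
    (α ≼? β) ×-dec jump? F β γ ×-dec decreasesFrom? j γ

  DecreasesFrom-antimono : ∀ j {α β} → α ≼ β → DecreasesFrom j β → DecreasesFrom j α
  DecreasesFrom-antimono zero    α≼β _ = tt
  DecreasesFrom-antimono (suc j) α≼β (γ , δ , β≼γ , rest) = γ , δ , ≼-trans α≼β β≼γ , rest

  decreaseAlong-jump : ∀ {α β} C → Jump F α β →
                       suc (decreaseAlong (β ∷ C) F) ≤ decreaseAlong (α ∷ β ∷ C) F
  decreaseAlong-jump C jump =
    ℕ.≤-reflexive (cong length (sym (filter-accept (uncurry (jump? F)) jump)))

  decreaseAlong-∷ : ∀ α β C → decreaseAlong (β ∷ C) F ≤ decreaseAlong (α ∷ β ∷ C) F
  decreaseAlong-∷ α β C = case jump? F α β of λ where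
    (yes jump) → ℕ.≤-trans (ℕ.n≤1+n _) (decreaseAlong-jump C jump)
    (no ¬jump) → ℕ.≤-reflexive (cong length (sym (filter-reject (uncurry (jump? F)) ¬jump)))

  -- The count is only bounded below, because the connecting link from `α` to `β` may itself be a
  -- jump.
  chainFrom : ∀ j α → DecreasesFrom j α →
              ∃[ C ] Linked _≺_ (α ∷ C) × j ≤ decreaseAlong (α ∷ C) F
  chainFrom zero    α _ = [] , [-] , z≤n
  chainFrom (suc j) α (β , γ , α≼β , jump , rest)
    with C , linked , j≤ ← chainFrom j γ rest | α ≟ β
  -- A chain has distinct tuples, so `β` is inserted only when it differs from `α`.
  ... | yes refl = γ ∷ C , Jump⇒≺ jump ∷ linked ,
                   ℕ.≤-trans (s≤s j≤) (decreaseAlong-jump C jump)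
  ... | no α≢β   = β ∷ γ ∷ C , (α≼β , α≢β) ∷ Jump⇒≺ jump ∷ linked ,
                   ℕ.≤-trans (s≤s j≤) (ℕ.≤-trans (decreaseAlong-jump C jump)
                                                  (decreaseAlong-∷ α β (γ ∷ C)))

  module _ {d} (isDecrease : IsDecrease F d) where

    DecreasesFrom⇒≤ : ∀ {α} j → DecreasesFrom j α → j ≤ d
    DecreasesFrom⇒≤ {α} j dec with C , linked , j≤ ← chainFrom j α dec =
      ℕ.≤-trans j≤ (proj₂ isDecrease _ (α ∷ C , Linked-≺⇒IsChain linked , refl))

    decreaseFrom : ∀ α → ∃[ m ] IsMaximum (λ j → DecreasesFrom j α) m
    decreaseFrom α = maximum (λ j → decreasesFrom? j α) tt d DecreasesFrom⇒≤

    decrease⇒rank : ∀ {s} → suc d ≤ s → Rank (List.lookup F) s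
    decrease⇒rank {s} d<s = record
      { rank = λ α → fromℕ< (height<s α)
      ; rank-mono = λ {α} {β} α≼β →
          subst₂ _≤_ (sym (Fin.toℕ-fromℕ< (height<s α))) (sym (Fin.toℕ-fromℕ< (height<s β)))
            (ℕ.∸-monoʳ-≤ d (from-max α _
              (DecreasesFrom-antimono (from β) α≼β (from-attained β))))
      ; rank-jumps = λ {α} {β} i α≼β jump →
          subst₂ _<_ (sym (Fin.toℕ-fromℕ< (height<s α))) (sym (Fin.toℕ-fromℕ< (height<s β)))
            (ℕ.∸-monoʳ-< (from-max α _
              -- Prefixing the jump from `α` to `β` to a longest sequence of jumps from `β` gives
              -- one more jump from `α`.
              (α , β , ≼-refl , (α≼β , lose (∈ˡ-lookup i) jump) , from-attained β))
              -- The bound by `d` keeps the truncated subtraction strict.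
              (DecreasesFrom⇒≤ (from α) (from-attained α)))
      }
      where
      from : Tuple k n → ℕ
      from α = proj₁ (decreaseFrom α)

      from-attained : ∀ α → DecreasesFrom (from α) α
      from-attained α = proj₁ (proj₂ (decreaseFrom α))

      from-max : ∀ α j → DecreasesFrom j α → j ≤ from α
      from-max α = proj₂ (proj₂ (decreaseFrom α))

      height<s : ∀ α → d ∸ from α < s
      height<s α = ℕ.≤-<-trans (ℕ.m∸n≤m d (from α)) d<s

-- Circuits and the appending of a gate

module _ {k n : ℕ} {B : Basis k} where

  valuesAt : (S : Circuit B n) → ∀ {m} → Vec (Fin (size S)) m → Tuple k n → Tuple k m
  valuesAt S vs x = map (λ v → value S v x) vs

  eval-input : ∀ (S : Circuit B n) {v i} → label S v ≡ input i →
               ∀ a x → eval S v a x ≡ lookup x i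
  eval-input S {v} eq (acc _) x with input i ← label S v | refl ← eq = refl

  inputs : Circuit B n
  inputs = record
    { size = n ; label = input ; acyclic = λ { v [ () ] ; v (() ∷ _) } }

  nonMonotoneComplexity-inputs : nonMonotoneComplexity inputs ≡ 0
  nonMonotoneComplexity-inputs = sum-zeros n
    where
    sum-zeros : ∀ m → sum (tabulate {n = m} (λ _ → 0)) ≡ 0
    sum-zeros zero    = refl
    sum-zeros (suc m) = sum-zeros m

  shift : ∀ {s} → Label B n s → Label B n (suc s)
  shift (input i)       = input i
  shift (gate b∈B args) = gate b∈B (map suc args)

  weight-shift : ∀ {s} (l : Label B n s) → weight (shift l) ≡ weight l
  weight-shift (input _)             = refl
  weight-shift (gate (monotone _) _) = refl
  weight-shift (gate (ω _) _)        = refl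

  ∈-map-suc⁻ : ∀ {s q} {w : Fin (suc s)} (args : Vec (Fin s) q) → w ∈ map suc args →
               ∃[ v ] w ≡ suc v × v ∈ args
  ∈-map-suc⁻ (v ∷ args) (VecAny.here refl) = v , refl , VecAny.here refl
  ∈-map-suc⁻ (v ∷ args) (VecAny.there w∈) with v′ , eq , v′∈ ← ∈-map-suc⁻ args w∈ =
    v′ , eq , VecAny.there v′∈

  IsPredecessor-shift⁻ : ∀ {s} {w : Fin (suc s)} (l : Label B n s) →
                         IsPredecessor w (shift l) → ∃[ v ] w ≡ suc v × IsPredecessor v l
  IsPredecessor-shift⁻ (gate _ args) = ∈-map-suc⁻ args

  module _ (S : Circuit B n) {q} {f : P k q} (f∈B : B ∋ f) (args : Vec (Fin (size S)) q) where

    private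
      label⁺ : Fin (suc (size S)) → Label B n (suc (size S))
      label⁺ zero    = gate f∈B (map suc args)
      label⁺ (suc v) = shift (label S v)

      _⟶⁺_ : Fin (suc (size S)) → Fin (suc (size S)) → Set
      w ⟶⁺ v = IsPredecessor w (label⁺ v)

      source-suc : ∀ {w} v → w ⟶⁺ v → ∃[ w′ ] w ≡ suc w′
      source-suc zero    e with w′ , eq , _ ← ∈-map-suc⁻ args e = w′ , eq
      source-suc (suc v) e with w′ , eq , _ ← IsPredecessor-shift⁻ (label S v) e = w′ , eq

      path-source-suc : ∀ {w v} → TransClosure _⟶⁺_ w v → ∃[ w′ ] w ≡ suc w′
      path-source-suc {v = v} [ e ] = source-suc v e
      path-source-suc (_∷_ {y = y} e _) = source-suc y e

      edge-suc⁻ : ∀ {w v} → suc w ⟶⁺ suc v → Circuit._⟶_ S w v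
      edge-suc⁻ {v = v} e with _ , refl , e′ ← IsPredecessor-shift⁻ (label S v) e = e′

      path-suc⁻ : ∀ {w v} → TransClosure _⟶⁺_ (suc w) (suc v) →
                  TransClosure (Circuit._⟶_ S) w v
      path-suc⁻ [ e ]   = [ edge-suc⁻ e ]
      path-suc⁻ (e ∷ p) with _ , refl ← path-source-suc p = edge-suc⁻ e ∷ path-suc⁻ p

      -- All argument vectors are images under `suc`, so no node reads the new gate `zero` and no
      -- cycle passes through it. A cycle through old nodes would be a cycle of `S`.
      acyclic⁺ : ∀ v → ¬ TransClosure _⟶⁺_ v v
      acyclic⁺ zero    p with _ , () ← path-source-suc p
      acyclic⁺ (suc v) p = acyclic S v (path-suc⁻ p)

    append : Circuit B n
    append = record { size = suc (size S) ; label = label⁺ ; acyclic = acyclic⁺ }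

    mutual
      -- The two accessibility proofs are arbitrary, so none has to be identified with another. The
      -- equation `w ≡ suc v` is a hypothesis because an entry of `map suc args` has the form
      -- `suc v` only propositionally.
      eval-append : ∀ {w v} → w ≡ suc v → ∀ a⁺ a x → eval append w a⁺ x ≡ eval S v a x
      eval-append refl (acc rs⁺) (acc rs) = evalLabel-shift (label S _) rs⁺ rs

      evalLabel-shift : ∀ l (rs⁺ : ∀ {w} → IsPredecessor w (shift l) → Acc _⟶⁺_ w)
                          (rs : ∀ {w} → IsPredecessor w l → Acc (Circuit._⟶_ S) w) x →
                        evalLabel append (shift l) rs⁺ x ≡ evalLabel S l rs x
      evalLabel-shift (input i)                 rs⁺ rs x = refl
      evalLabel-shift (gate {f = g} _ args′) rs⁺ rs x =
        cong g (tabulate-cong λ j → eval-append (lookup-map j suc args′)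
          (rs⁺ (∈-lookup j (map suc args′))) (rs (∈-lookup j args′)) x)

    value-append-suc : ∀ v x → value append (suc v) x ≡ value S v x
    value-append-suc v =
      eval-append refl (Circuit.⟶-wellFounded append (suc v)) (Circuit.⟶-wellFounded S v)

    value-append-zero : ∀ x → value append zero x ≡ f (valuesAt S args x)
    value-append-zero x = go (Circuit.⟶-wellFounded append zero)
      where
      -- With the accessibility proof abstracted, it can be matched as `acc`, and `eval` unfolds.
      go : ∀ a → eval append zero a x ≡ f (valuesAt S args x)
      go (acc rs) = cong f (begin
        tabulate (λ j → eval append (lookup (map suc args) j) (rs (∈-lookup j (map suc args))) x)
          ≡⟨ tabulate-cong (λ j → eval-append (lookup-map j suc args)
               (rs (∈-lookup j (map suc args))) (Circuit.⟶-wellFounded S (lookup args j)) x) ⟩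
        tabulate (λ j → value S (lookup args j) x)
          ≡⟨ tabulate-∘ _ (lookup args) ⟩
        valuesAt S (tabulate (lookup args)) x
          ≡⟨ cong (λ vs → valuesAt S vs x) (tabulate∘lookup args) ⟩
        valuesAt S args x ∎)
        where open ≡-Reasoning

    nonMonotoneComplexity-append :
      nonMonotoneComplexity append ≡
      weight {B = B} (gate {n = n} f∈B args) + nonMonotoneComplexity S
    nonMonotoneComplexity-append =
      cong₂ _+_ (weight-shift (gate f∈B args))
        (cong sum (tabulate-cong λ v → weight-shift (label S v)))

  -- Extensions of circuits and their cost

  record _⊑[_]_ (S : Circuit B n) (c : ℕ) (S⁺ : Circuit B n) : Set where
    field
      embed       : Fin (size S) → Fin (size S⁺)
      value-embed : ∀ v x → value S⁺ (embed v) x ≡ value S v x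
      cost        : nonMonotoneComplexity S⁺ ≤ c + nonMonotoneComplexity S

    valuesAt-embed : ∀ {m} (vs : Vec (Fin (size S)) m) x →
                     valuesAt S⁺ (map embed vs) x ≡ valuesAt S vs x
    valuesAt-embed vs x =
      trans (sym (map-∘ _ embed vs)) (map-cong (λ v → value-embed v x) vs)

  open _⊑[_]_

  ⊑-refl : ∀ {S} → S ⊑[ 0 ] S
  ⊑-refl = record { embed = λ v → v ; value-embed = λ _ _ → refl ; cost = ℕ.≤-refl }

  ⊑-trans : ∀ {S₁ S₂ S₃ c₁ c₂} → S₁ ⊑[ c₁ ] S₂ → S₂ ⊑[ c₂ ] S₃ → S₁ ⊑[ c₂ + c₁ ] S₃
  ⊑-trans {c₁ = c₁} {c₂} p q = record
    { embed       = embed q ∘ embed p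
    ; value-embed = λ v x → trans (value-embed q _ x) (value-embed p v x)
    ; cost        = ℕ.≤-trans (cost q) (ℕ.≤-trans (ℕ.+-monoʳ-≤ c₂ (cost p))
                      (ℕ.≤-reflexive (sym (ℕ.+-assoc c₂ c₁ _))))
    }

  ⊑-append : ∀ S {q} {f : P k q} (f∈B : B ∋ f) (args : Vec (Fin (size S)) q) {c} →
             weight {B = B} (gate {n = n} f∈B args) ≤ c → S ⊑[ c ] append S f∈B args
  ⊑-append S f∈B args w≤c = record
    { embed       = suc
    ; value-embed = value-append-suc S f∈B args
    ; cost        = ℕ.≤-trans (ℕ.≤-reflexive (nonMonotoneComplexity-append S f∈B args))
                              (ℕ.+-monoˡ-≤ _ w≤c)
    }

  weight≤1 : ∀ {s} (l : Label B n s) → weight l ≤ 1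
  weight≤1 (input _)             = z≤n
  weight≤1 (gate (monotone _) _) = z≤n
  weight≤1 (gate (ω _) _)        = ℕ.≤-refl

  -- The functions in `G` read the nodes `vs` instead of the circuit inputs. This lets an already
  -- computed function serve as an additional variable.
  record Extension (S : Circuit B n) (c : ℕ) {m} (vs : Vec (Fin (size S)) m)
                   {r} (G : Fin r → P k m) : Set where
    field
      circuit    : Circuit B n
      extends    : S ⊑[ c ] circuit
      node       : Fin r → Fin (size circuit)
      value-node : ∀ i x → value circuit (node i) x ≡ G i (valuesAt S vs x)

  open Extension

  extendMonotone : ∀ S {m} (vs : Vec (Fin (size S)) m) {r} (G : Fin r → P k m) →
                   (∀ i → Monotone (G i)) → Extension S 0 vs G
  extendMonotone S vs {zero}  G mono = record
    { circuit = S ; extends = ⊑-refl ; node = λ () ; value-node = λ () }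
  extendMonotone S vs {suc r} G mono = record
    { circuit    = circuit E
    ; extends    = ⊑-trans S⊑S₁ (extends E)
    -- `G zero` sits at the gate `zero` of the intermediate circuit and is carried along by the
    -- later appends.
    ; node       = λ { zero → embed (extends E) zero ; (suc i) → node E i }
    ; value-node = λ
        { zero x    → trans (value-embed (extends E) zero x)
                            (value-append-zero S (monotone {f = G zero} (mono zero)) vs x)
        ; (suc i) x → trans (value-node E i x) (cong (G (suc i)) (valuesAt-embed S⊑S₁ vs x)) }
    }
    where
    S⊑S₁ : S ⊑[ 0 ] append S (monotone (mono zero)) vs
    S⊑S₁ = ⊑-append S (monotone (mono zero)) vs ℕ.≤-refl

    E = extendMonotone (append S (monotone (mono zero)) vs) (map suc vs) (G ∘ suc) (mono ∘ suc)

-- Extending values off the graph of an antitone function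

clamp : ∀ {k r} → Fin k → Fin k → Fin r → Fin r
clamp {r = suc r} y w v with Fin.<-cmp y w
... | tri< _ _ _ = zero
... | tri≈ _ _ _ = v
... | tri> _ _ _ = fromℕ r

clamp-≡ : ∀ {k r} {y w : Fin k} (v : Fin r) → y ≡ w → clamp y w v ≡ v
clamp-≡ {r = suc r} {y} {w} v y≡w with Fin.<-cmp y w
... | tri< _ y≢w _ = contradiction y≡w y≢w
... | tri≈ _ _ _   = refl
... | tri> _ y≢w _ = contradiction y≡w y≢w

-- If `y < w`, the left clamp is the least element; if `y′ > w′`, the right one is the greatest.
-- Otherwise `w ≤ y ≤ y′ ≤ w′ ≤ w`, and all four coincide. The second alternative holds for every
-- `r`, as it is applied both to function values in `Fin k` and to remainders in `Fin s`.
clamp-cases : ∀ {k} {y y′ w w′ : Fin k} → y ≤ᶠ y′ → w′ ≤ᶠ w →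
              (y ≡ w × y′ ≡ w′ × w ≡ w′) ⊎
              (∀ {r} (v v′ : Fin r) → clamp y w v ≤ᶠ clamp y′ w′ v′)
clamp-cases {y = y} {y′} {w} {w′} y≤y′ w′≤w
  with Fin.<-cmp y w in eq | Fin.<-cmp y′ w′ in eq′
... | tri< _ _ _    | _ = inj₂ λ { {suc r} v v′ → below {r} v v′ }
  where
  below : ∀ {r} (v v′ : Fin (suc r)) → clamp y w v ≤ᶠ clamp y′ w′ v′
  below v v′ rewrite eq = z≤n
... | tri≈ _ _ _    | tri> _ _ _ = inj₂ λ { {suc r} v v′ → above {r} v v′ }
  where
  above : ∀ {r} (v v′ : Fin (suc r)) → clamp y w v ≤ᶠ clamp y′ w′ v′
  above v v′ rewrite eq′ = Fin.≤fromℕ _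
... | tri> _ _ _    | tri> _ _ _ = inj₂ λ { {suc r} v v′ → above {r} v v′ }
  where
  above : ∀ {r} (v v′ : Fin (suc r)) → clamp y w v ≤ᶠ clamp y′ w′ v′
  above v v′ rewrite eq′ = Fin.≤fromℕ _
... | tri≈ _ refl _ | tri≈ _ refl _ = inj₁ (refl , refl , Fin.≤-antisym y≤y′ w′≤w)
... | tri≈ _ refl _ | tri< y′<w′ _ _ =
  contradiction (ℕ.<-≤-trans y′<w′ (ℕ.≤-trans w′≤w y≤y′)) (ℕ.<-irrefl refl)
... | tri> _ _ w<y  | tri≈ _ refl _ =
  contradiction (ℕ.<-≤-trans w<y (ℕ.≤-trans y≤y′ w′≤w)) (ℕ.<-irrefl refl)
... | tri> _ _ w<y  | tri< y′<w′ _ _ =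
  contradiction (ℕ.<-≤-trans (ℕ.<-trans y′<w′ (ℕ.≤-<-trans w′≤w w<y)) y≤y′) (ℕ.<-irrefl refl)

-- Division with remainder and order

module _ {u : ℕ} (s : ℕ) where

  private
    quot : Fin (u * s) → Fin u
    quot = quotient {u} s

    rem : Fin (u * s) → Fin s
    rem = remainder {u} s

  combine-quotient-remainder : ∀ i → combine (quot i) (rem i) ≡ i
  combine-quotient-remainder = Fin.combine-remQuot {u} s

  -- `combine` is ordered lexicographically, so a smaller quotient of `j` would force `j < i`.
  quotient-mono : ∀ {i j} → i ≤ᶠ j → quot i ≤ᶠ quot j
  quotient-mono {i} {j} i≤j = ℕ.≮⇒≥ λ qj<qi → ℕ.<⇒≱
    (subst₂ _<ᶠ_ (combine-quotient-remainder j) (combine-quotient-remainder i)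
      (Fin.combine-monoˡ-< (rem j) (rem i) qj<qi)) i≤j

  toℕ-quotient-remainder : ∀ i → toℕ i ≡ s * toℕ (quot i) + toℕ (rem i)
  toℕ-quotient-remainder i =
    trans (cong toℕ (sym (combine-quotient-remainder i))) (Fin.toℕ-combine (quot i) (rem i))

  remainder-mono-< : ∀ {i j} → quot i ≡ quot j → i <ᶠ j → rem i <ᶠ rem j
  remainder-mono-< {i} {j} eq i<j =
    ℕ.+-cancelˡ-< (s * toℕ (quot j)) _ _
      (subst₂ _<_ (trans (toℕ-quotient-remainder i) (cong (λ a → s * toℕ a + toℕ (rem i)) eq))
                  (toℕ-quotient-remainder j) i<j)

  remainder-mono-≤ : ∀ {i j} → quot i ≡ quot j → i ≤ᶠ j → rem i ≤ᶠ rem j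
  remainder-mono-≤ {i} {j} eq i≤j =
    ℕ.+-cancelˡ-≤ (s * toℕ (quot j)) _ _
      (subst₂ _≤_ (trans (toℕ-quotient-remainder i) (cong (λ a → s * toℕ a + toℕ (rem i)) eq))
                  (toℕ-quotient-remainder j) i≤j)

-- Chains along which a function descends

record DescendingChain {k q} (f : P k q) (u : ℕ) : Set where
  field
    point      : Fin u → Tuple k q
    point-mono : ∀ {i j} → i ≤ᶠ j → point i ≼ point j
    descends   : ∀ {i j} → i <ᶠ j → f (point j) <ᶠ f (point i)

  descends-≤ : ∀ {i j} → i ≤ᶠ j → f (point j) ≤ᶠ f (point i)
  descends-≤ {i} {j} i≤j with Fin._≟_ i j
  ... | yes refl = ℕ.≤-refl
  ... | no i≢j   = ℕ.<⇒≤ (descends (Fin.≤∧≢⇒< i≤j i≢j))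

  descends-injective : ∀ {i j} → i ≤ᶠ j → f (point i) ≡ f (point j) → i ≡ j
  descends-injective {i} {j} i≤j eq with Fin._≟_ i j
  ... | yes i≡j = i≡j
  ... | no i≢j  = contradiction (sym eq) (Fin.<⇒≢ (descends (Fin.≤∧≢⇒< i≤j i≢j)))

-- Neighbours in `βs` need not be neighbours in `C`. Transitivity first makes all pairs of `C`
-- comparable, and this passes to subsequences.
descendingChain : ∀ {k q} {f : P k q} {C βs} → IsChain C → βs ⊆ C →
                  Linked (λ α β → f β <ᶠ f α) βs → DescendingChain f (length βs)
descendingChain {βs = βs} (_ , linked) βs⊆C desc = record
  { point      = List.lookup βs
  ; point-mono = mono
  ; descends   = AllPairs-lookup (Linked⇒AllPairs (λ p q → ℕ.<-trans q p) desc)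
  }
  where
  mono : ∀ {i j} → i ≤ᶠ j → List.lookup βs i ≼ List.lookup βs j
  mono {i} {j} i≤j with Fin._≟_ i j
  ... | yes refl = ≼-refl
  ... | no i≢j   = AllPairs-lookup (AllPairs-resp-⊆ βs⊆C (Linked⇒AllPairs ≼-trans linked))
                                   (Fin.≤∧≢⇒< i≤j i≢j)

-- Splitting off one non-monotone function

module _ {k m r q u s : ℕ} {G : Fin r → P k m} {f : P k q}
         (chain : DescendingChain f u) (R : Rank G (u * s)) where

  open DescendingChain chain
  open Rank R

  level : Tuple k m → Fin u
  level α = quotient {u} s (rank α)

  level-mono : ∀ {α β} → α ≼ β → level α ≤ᶠ level β
  level-mono α≼β = quotient-mono s (rank-mono α≼β)

  -- These are the components of the tuple h of monotone functions, separated because each becomes a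
  -- gate of weight 0.
  coordinate : Fin q → P k m
  coordinate j α = lookup (point (level α)) j

  coordinate-mono : ∀ j → Monotone (coordinate j)
  coordinate-mono j α≼β = Pointwise.lookup (point-mono (level-mono α≼β)) j

  marker : P k m
  marker α = f (point (level α))

  marked : Fin r → P k (suc m)
  marked i (y ∷ α) = clamp y (marker α) (G i α)

  markedRank : Rank marked s
  markedRank = record
    { rank       = λ { (y ∷ α) → clamp y (marker α) (remainder {u} s (rank α)) }
    ; rank-mono  = λ { {y ∷ α} {y′ ∷ β} (y≤y′ ∷ α≼β) → mono y≤y′ α≼β }
    ; rank-jumps = λ { {y ∷ α} {y′ ∷ β} i (y≤y′ ∷ α≼β) → jumps i y≤y′ α≼β }
    }
    where
    -- The levels of comparable tuples are comparable, and `f` takes different values at different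
    -- points of the descending chain.
    level-≡ : ∀ {α β} → α ≼ β → marker α ≡ marker β → level α ≡ level β
    level-≡ α≼β = descends-injective (level-mono α≼β)

    mono : ∀ {y y′ α β} → y ≤ᶠ y′ → α ≼ β →
           clamp y (marker α) (remainder {u} s (rank α)) ≤ᶠ
           clamp y′ (marker β) (remainder {u} s (rank β))
    mono y≤y′ α≼β with clamp-cases y≤y′ (descends-≤ (level-mono α≼β))
    ... | inj₂ ≤ = ≤ _ _
    ... | inj₁ (y≡ , y′≡ , w≡) = subst₂ _≤ᶠ_ (sym (clamp-≡ _ y≡)) (sym (clamp-≡ _ y′≡))
      (remainder-mono-≤ s (level-≡ α≼β w≡) (rank-mono α≼β))

    jumps : ∀ {y y′ α β} i → y ≤ᶠ y′ → α ≼ β →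
            clamp y′ (marker β) (G i β) <ᶠ clamp y (marker α) (G i α) →
            clamp y (marker α) (remainder {u} s (rank α)) <ᶠ
            clamp y′ (marker β) (remainder {u} s (rank β))
    jumps i y≤y′ α≼β jump with clamp-cases y≤y′ (descends-≤ (level-mono α≼β))
    -- Off the graph the clamped values cannot fall, whatever `G i` is.
    ... | inj₂ ≤ = contradiction (≤ _ _) (ℕ.<⇒≱ jump)
    -- On the graph both clamps are transparent, so the jump is one of `G i` and raises `rank`. The
    -- level is unchanged, hence the remainder rises.
    ... | inj₁ (y≡ , y′≡ , w≡) = subst₂ _<ᶠ_ (sym (clamp-≡ _ y≡)) (sym (clamp-≡ _ y′≡))
      (remainder-mono-< s (level-≡ α≼β w≡)
        (rank-jumps i α≼β (subst₂ _<ᶠ_ (clamp-≡ _ y′≡) (clamp-≡ _ y≡) jump)))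

-- A jump would need two distinct ranks, and `Fin 1` has only one element.
rank-one⇒monotone : ∀ {k m r} {G : Fin r → P k m} → Rank G 1 → ∀ i → Monotone (G i)
rank-one⇒monotone R i {α} {β} α≼β = ℕ.≮⇒≥ λ jump →
  ℕ.n≮0 (ℕ.<-≤-trans (Rank.rank-jumps R i α≼β jump) (ℕ.≤-pred (Fin.toℕ<n (Rank.rank R β))))

-- Recursion on the exponent

module _ {k n : ℕ} {B : Basis k} where

  open _⊑[_]_
  open Extension

  -- The circuit, the nodes read and the family all vary in the recursion: each round adds one
  -- variable, fed by the new gate, and divides the number of ranks by `u`.
  extend : ∀ {q u} {f : P k q} → B ∋ f → DescendingChain f u →
           ∀ t (S : Circuit B n) {m} (vs : Vec (Fin (size S)) m) {r} (G : Fin r → P k m) →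
           Rank G (u ^ t) → Extension S t vs G
  extend f∈B chain zero    S vs G R = extendMonotone S vs G (rank-one⇒monotone R)
  extend {u = u} {f} f∈B chain (suc t) S vs G R = record
    { circuit    = circuit E₂
    -- Composition yields the cost `t + 1`, while `suc t` unfolds to `1 + t`.
    ; extends    = subst (λ c → S ⊑[ c ] circuit E₂) (ℕ.+-comm t 1) (⊑-trans S⊑S₂ (extends E₂))
    ; node       = node E₂
    ; value-node = λ i x → begin
        value (circuit E₂) (node E₂ i) x
          ≡⟨ value-node E₂ i x ⟩
        marked chain R i (value S₂ zero x ∷ valuesAt S₂ (map (embed S⊑S₂) vs) x)
          ≡⟨ cong₂ (λ y α → marked chain R i (y ∷ α)) (value-marker x) (valuesAt-embed S⊑S₂ vs x) ⟩
        marked chain R i (marker chain R (valuesAt S vs x) ∷ valuesAt S vs x)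
          -- The first variable is exactly the marker, so the evaluation lies on its graph.
          ≡⟨ clamp-≡ _ refl ⟩
        G i (valuesAt S vs x) ∎
    }
    where
    open ≡-Reasoning

    E₁ : Extension S 0 vs (coordinate chain R)
    E₁ = extendMonotone S vs (coordinate chain R) (coordinate-mono chain R)

    S₂ : Circuit B n
    S₂ = append (circuit E₁) f∈B (tabulate (node E₁))

    S⊑S₂ : S ⊑[ 1 ] S₂
    S⊑S₂ = ⊑-trans (extends E₁)
      (⊑-append (circuit E₁) f∈B (tabulate (node E₁)) (weight≤1 (gate f∈B (tabulate (node E₁)))))

    value-marker : ∀ x → value S₂ zero x ≡ marker chain R (valuesAt S vs x)
    value-marker x = begin
      value S₂ zero x
        ≡⟨ value-append-zero (circuit E₁) f∈B _ x ⟩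
      f (valuesAt (circuit E₁) (tabulate (node E₁)) x)
        ≡⟨ cong f (tabulate-∘ _ (node E₁)) ⟨
      f (tabulate (λ j → value (circuit E₁) (node E₁ j) x))
        ≡⟨ cong f (tabulate-cong (λ j → value-node E₁ j x)) ⟩
      f (tabulate (λ j → coordinate chain R j (valuesAt S vs x)))
        ≡⟨ cong f (tabulate∘lookup _) ⟩
      marker chain R (valuesAt S vs x) ∎

    -- The gate `zero` computes the marker and comes first, matching the new first variable of
    -- `marked`.
    E₂ : Extension S₂ t (zero ∷ map (embed S⊑S₂) vs) (marked chain R)
    E₂ = extend f∈B chain t S₂ (zero ∷ map (embed S⊑S₂) vs) (marked chain R) (markedRank chain R)

-- Assembly, starting from the circuit of inputs alone

theorem2 : ∀ {k : ℕ} → 2 ≤ k → (B : Basis k) →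
    ∀ {n : ℕ} (F : List (P k n)) {d u t : ℕ} →
    IsDecrease F d →
    IsBasisInversionPower B u →
    IsCeilLog u (suc d) t →
    (Σ[ S ∈ Circuit B n ] (Realizes S F × nonMonotoneComplexity S ≤ t)) ×
    (∀ {c : ℕ} → IsNonMonotoneComplexity B F c → c ≤ t)
-- The inversion power of the basis is attained by some `f` in `B` on a subsequence `βs` of a chain
-- `C`, and matching `refl` turns `u` into `length βs`. The hypothesis `d<uᵗ` is `suc d ≤ u ^ t`.
theorem2 {k} _ B {n} F {t = t} isDecrease
  ((_ , _ , f∈B , (C , isChain , (βs , βs⊆C , desc , refl) , _) , _) , _) (d<uᵗ , _) =
  (circuit , realizes , complexity≤t) ,
  λ (_ , minimal) → ℕ.≤-trans (minimal _ (circuit , realizes , refl)) complexity≤t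
  where
  vars : Vec (Fin n) n
  vars = tabulate (λ i → i)

  open Extension (extend f∈B (descendingChain isChain βs⊆C desc) t (inputs {B = B}) vars
                    (List.lookup F) (decrease⇒rank F isDecrease d<uᵗ))

  valuesAt-vars : ∀ x → valuesAt (inputs {B = B}) vars x ≡ x
  valuesAt-vars x = begin
    valuesAt (inputs {B = B}) vars x          ≡⟨ tabulate-∘ _ (λ i → i) ⟨
    tabulate (λ i → value (inputs {B = B}) i x) ≡⟨ tabulate-cong (λ i →
      eval-input (inputs {B = B}) refl (Circuit.⟶-wellFounded (inputs {B = B}) i) x) ⟩
    tabulate (lookup x)                       ≡⟨ tabulate∘lookup x ⟩
    x                                         ∎
    where open ≡-Reasoning

  realizes : Realizes circuit F
  -- The extension computes `F` by position, so a membership proof is turned into its index.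
  realizes = All.tabulate λ {g} g∈F → node (Any.index g∈F) , λ x → begin
    value circuit (node (Any.index g∈F)) x
      ≡⟨ value-node (Any.index g∈F) x ⟩
    List.lookup F (Any.index g∈F) (valuesAt inputs vars x)
      ≡⟨ cong (List.lookup F (Any.index g∈F)) (valuesAt-vars x) ⟩
    List.lookup F (Any.index g∈F) x
      ≡⟨ cong (λ h → h x) (lookup-index g∈F) ⟨
    g x ∎
    where open ≡-Reasoning

  complexity≤t : nonMonotoneComplexity circuit ≤ t
  complexity≤t = ℕ.≤-trans (_⊑[_]_.cost extends)
    (ℕ.≤-reflexive
      (trans (cong (t +_) (nonMonotoneComplexity-inputs {n = n} {B = B})) (ℕ.+-identityʳ t)))
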